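{- Let $p\geq 2$ and let $G$ be the competition-common enemy graph of a digraph $D$ which satisfies Conditions $C(p)$ and $C'(p)$. Let $I_G$ be the set of isolated vertices of $G$, and suppose that $G-I_G$ has at least $p$ vertices. Then the vertex set of $G-I_G$ is a clique of $G$ (i.e., any two distinct non-isolated vertices of $G$ are adjacent).
   Context: All digraphs are finite. For a digraph $D$ and vertex $x$, $N^+_D(x)=\{v \mid (x,v)\in A(D)\}$ and $N^-_D(x)=\{v \mid (v,x)\in A(D)\}$. The competition-common enemy graph of $D$ is the simple undirected graph on $V(D)$ in which distinct $x,y$ are adjacent iff $N^+_D(x)\cap N^+_D(y)\neq\emptyset$ and $N^-_D(x)\cap N^-_D(y)\neq\emptyset$. For a vertex set $S$, $\mathcal{F}^+_D(S):=\{x\in S \mid N^+_D(x)\subseteq N^+_D(y)\ \forall y\in S\}$ and $\mathcal{F}^-_D(S):=\{x\in S \mid N^-_D(x)\subseteq N^-_D(y)\ \forall y\in S\}$. For an integer $p\geq2$, $D$ satisfies Condition $C(p)$ (resp. $C'(p)$) if $\mathcal{F}^+_D(S)\neq\emptyset$ (resp. $\mathcal{F}^-_D(S)\neq\emptyset$) for every set $S$ of exactly $p$ vertices of $D$. -}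

module Defs where

open import Data.Nat using (ℕ; _≤_)
open import Data.Fin using (Fin)
open import Data.Fin.Subset using (Subset; _∈_; ∣_∣)
open import Data.Product using (_×_; ∃-syntax)
open import Relation.Binary.PropositionalEquality using (_≡_)
open import Relation.Nullary using (¬_; Dec)

record Digraph (n : ℕ) : Set₁ where
  field
    Arc     : Fin n → Fin n → Set
    arc?     : ∀ x y → Dec (Arc x y)
    loopless : ∀ x → ¬ Arc x x

module _ {n : ℕ} (D : Digraph n) where
  open Digraph D

  Out : Fin n → Fin n → Set
  Out x v = Arc x v

  In : Fin n → Fin n → Set
  In x v = Arc v x

  CCEAdj : Fin n → Fin n → Set
  CCEAdj x y = ¬ (x ≡ y) × (∃[ v ] (Out x v × Out y v)) × (∃[ w ] (In x w × In y w))

  OutSub : Fin n → Fin n → Set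
  OutSub x y = ∀ v → Out x v → Out y v

  InSub : Fin n → Fin n → Set
  InSub x y = ∀ v → In x v → In y v

  InF⁺ : Subset n → Fin n → Set
  InF⁺ S x = x ∈ S × (∀ y → y ∈ S → OutSub x y)

  InF⁻ : Subset n → Fin n → Set
  InF⁻ S x = x ∈ S × (∀ y → y ∈ S → InSub x y)

  ConditionC : ℕ → Set
  ConditionC p = ∀ (S : Subset n) → ∣ S ∣ ≡ p → ∃[ x ] InF⁺ S x

  ConditionC' : ℕ → Set
  ConditionC' p = ∀ (S : Subset n) → ∣ S ∣ ≡ p → ∃[ x ] InF⁻ S x

  Isolated : Fin n → Set
  Isolated x = ∀ y → ¬ CCEAdj x y

  NonIsolated : Subset n → Set
  NonIsolated T = ∀ x → (x ∈ T → ¬ Isolated x) × (¬ Isolated x → x ∈ T)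

module Submission where

-- Let x ≠ y be non-isolated vertices, i.e. members of the vertex
-- set T of G − I_G.  Since 2 ≤ p ≤ |T|, the pair {x, y} extends to a set
-- U ⊆ T of exactly p vertices.  Condition C(p) yields z ∈ U whose
-- out-neighbourhood is contained in that of every vertex of U, in particular
-- of x and y.  As z ∈ T is not isolated, z has an out-neighbour v, which is
-- then a common prey of x and y.  Dually, C'(p) yields a common enemy, so
-- x and y are adjacent in G.

open import Defs
open import Data.Nat using (ℕ; _≤_; _+_; suc; z≤n; s≤s)
open import Data.Nat.Properties
  using (≤-trans; ≤-antisym; ≰⇒>; _≤?_; +-suc; m≤n⇒m≤1+n)
open import Data.Fin using (Fin)
open import Data.Fin.Subset using (Subset; ∣_∣; _∈_; _⊆_; _∪_; ⁅_⁆; inside; outside)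
open import Data.Fin.Subset.Properties
  using (⊆-refl; drop-∷-⊆; out⊆; s⊆s; x∈⁅x⁆; x∈⁅y⁆⇒x≡y; x∈p∪q⁻; p⊆p∪q; q⊆p∪q; ∣⁅x⁆∣≡1)
open import Data.Fin.Properties using (any?)
open import Data.Vec using ([]; _∷_; here)
open import Data.Product using (_×_; _,_; proj₁; proj₂; ∃-syntax)
open import Data.Sum using (inj₁; inj₂)
open import Relation.Binary.PropositionalEquality using (_≡_; refl; sym; cong; cong₂; subst)
open import Relation.Nullary using (¬_; yes; no)
open import Data.Empty using (⊥-elim)

∣p∪q∣≤∣p∣+∣q∣ : ∀ {n} (p q : Subset n) → ∣ p ∪ q ∣ ≤ ∣ p ∣ + ∣ q ∣
∣p∪q∣≤∣p∣+∣q∣ []            []            = z≤n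
∣p∪q∣≤∣p∣+∣q∣ (inside  ∷ p) (inside  ∷ q) =
  s≤s (subst (∣ p ∪ q ∣ ≤_) (sym (+-suc ∣ p ∣ ∣ q ∣)) (m≤n⇒m≤1+n (∣p∪q∣≤∣p∣+∣q∣ p q)))
∣p∪q∣≤∣p∣+∣q∣ (inside  ∷ p) (outside ∷ q) = s≤s (∣p∪q∣≤∣p∣+∣q∣ p q)
∣p∪q∣≤∣p∣+∣q∣ (outside ∷ p) (inside  ∷ q) =
  subst (suc ∣ p ∪ q ∣ ≤_) (sym (+-suc ∣ p ∣ ∣ q ∣)) (s≤s (∣p∪q∣≤∣p∣+∣q∣ p q))
∣p∪q∣≤∣p∣+∣q∣ (outside ∷ p) (outside ∷ q) = ∣p∪q∣≤∣p∣+∣q∣ p q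

-- Between s ⊆ t there is a set of every size k with |s| ≤ k ≤ |t|.
-- Coordinatewise: an element of t outside s is kept exactly when the
-- remaining coordinates cannot reach size k without it.
intermediateSubset : ∀ {n} (s t : Subset n) → s ⊆ t → (k : ℕ) →
  ∣ s ∣ ≤ k → k ≤ ∣ t ∣ → ∃[ u ] (s ⊆ u × u ⊆ t × ∣ u ∣ ≡ k)
intermediateSubset [] [] _ _ z≤n z≤n = [] , (λ ()) , (λ ()) , refl
intermediateSubset (inside ∷ s) (outside ∷ t) s⊆t _ _ _ with s⊆t here
... | ()
intermediateSubset (inside ∷ s) (inside ∷ t) s⊆t (suc k) (s≤s s≤k) (s≤s k≤t)
  with intermediateSubset s t (drop-∷-⊆ s⊆t) k s≤k k≤t
... | u , s⊆u , u⊆t , ∣u∣≡k = inside ∷ u , s⊆s s⊆u , s⊆s u⊆t , cong suc ∣u∣≡k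
intermediateSubset (outside ∷ s) (outside ∷ t) s⊆t k s≤k k≤t
  with intermediateSubset s t (drop-∷-⊆ s⊆t) k s≤k k≤t
... | u , s⊆u , u⊆t , ∣u∣≡k = outside ∷ u , s⊆s s⊆u , s⊆s u⊆t , ∣u∣≡k
intermediateSubset (outside ∷ s) (inside ∷ t) s⊆t k s≤k k≤1+t with k ≤? ∣ t ∣
... | yes k≤t with intermediateSubset s t (drop-∷-⊆ s⊆t) k s≤k k≤t
...   | u , s⊆u , u⊆t , ∣u∣≡k = outside ∷ u , s⊆s s⊆u , out⊆ u⊆t , ∣u∣≡k
intermediateSubset (outside ∷ s) (inside ∷ t) s⊆t k s≤k k≤1+t | no k≰t =
  inside ∷ t , out⊆ (drop-∷-⊆ s⊆t) , ⊆-refl , ≤-antisym (≰⇒> k≰t) k≤1+t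

pairExtends : ∀ {n} (T : Subset n) (p : ℕ) → 2 ≤ p → p ≤ ∣ T ∣ →
  ∀ {x y : Fin n} → x ∈ T → y ∈ T → ∃[ U ] (x ∈ U × y ∈ U × U ⊆ T × ∣ U ∣ ≡ p)
pairExtends T p 2≤p p≤T {x} {y} x∈T y∈T
  with intermediateSubset (⁅ x ⁆ ∪ ⁅ y ⁆) T pair⊆T p ∣pair∣≤p p≤T
  where
  pair⊆T : ⁅ x ⁆ ∪ ⁅ y ⁆ ⊆ T
  pair⊆T z∈pair with x∈p∪q⁻ ⁅ x ⁆ ⁅ y ⁆ z∈pair
  ... | inj₁ z∈⁅x⁆ = subst (_∈ T) (sym (x∈⁅y⁆⇒x≡y x z∈⁅x⁆)) x∈T
  ... | inj₂ z∈⁅y⁆ = subst (_∈ T) (sym (x∈⁅y⁆⇒x≡y y z∈⁅y⁆)) y∈T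

  ∣pair∣≤p : ∣ ⁅ x ⁆ ∪ ⁅ y ⁆ ∣ ≤ p
  ∣pair∣≤p = ≤-trans (∣p∪q∣≤∣p∣+∣q∣ ⁅ x ⁆ ⁅ y ⁆)
    (subst (_≤ p) (sym (cong₂ _+_ (∣⁅x⁆∣≡1 x) (∣⁅x⁆∣≡1 y))) 2≤p)
... | U , pair⊆U , U⊆T , ∣U∣≡p =
  U , pair⊆U (p⊆p∪q ⁅ y ⁆ (x∈⁅x⁆ x)) , pair⊆U (q⊆p∪q ⁅ x ⁆ ⁅ y ⁆ (x∈⁅x⁆ y)) , U⊆T , ∣U∣≡p

module _ {n : ℕ} (D : Digraph n) where
  open Digraph D

  -- A vertex without out-neighbours (or without in-neighbours) competes with
  -- nobody, hence is isolated; by decidability of arcs, a non-isolated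
  -- vertex therefore has an out-neighbour and an in-neighbour.
  outNeighbour : ∀ {z} → ¬ Isolated D z → ∃[ v ] Out D z v
  outNeighbour {z} z-nonisolated with any? (arc? z)
  ... | yes z→v = z→v
  ... | no  no-out =
    ⊥-elim (z-nonisolated λ _ (_ , (v , z→v , _) , _) → no-out (v , z→v))

  inNeighbour : ∀ {z} → ¬ Isolated D z → ∃[ w ] In D z w
  inNeighbour {z} z-nonisolated with any? (λ w → arc? w z)
  ... | yes w→z = w→z
  ... | no  no-in =
    ⊥-elim (z-nonisolated λ _ (_ , _ , (w , w→z , _)) → no-in (w , w→z))

  commonPrey : ∀ {U z x y} → (∀ u → u ∈ U → ¬ Isolated D u) → InF⁺ D U z →
    x ∈ U → y ∈ U → ∃[ v ] (Out D x v × Out D y v)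
  commonPrey nonisolated (z∈U , z-minimal) x∈U y∈U
    with outNeighbour (nonisolated _ z∈U)
  ... | v , z→v = v , z-minimal _ x∈U v z→v , z-minimal _ y∈U v z→v

  commonEnemy : ∀ {U z x y} → (∀ u → u ∈ U → ¬ Isolated D u) → InF⁻ D U z →
    x ∈ U → y ∈ U → ∃[ w ] (In D x w × In D y w)
  commonEnemy nonisolated (z∈U , z-minimal) x∈U y∈U
    with inNeighbour (nonisolated _ z∈U)
  ... | w , w→z = w , z-minimal _ x∈U w w→z , z-minimal _ y∈U w w→z

proposition2p5 : ∀ {n : ℕ} (D : Digraph n) (p : ℕ) → 2 ≤ p →
    ConditionC D p → ConditionC' D p →
    (T : Subset n) → NonIsolated D T → p ≤ ∣ T ∣ →
    ∀ (x y : Fin n) → ¬ Isolated D x → ¬ Isolated D y → ¬ (x ≡ y) →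
    CCEAdj D x y
proposition2p5 D p 2≤p C C' T T-spec p≤T x y x-noniso y-noniso x≢y
  with pairExtends T p 2≤p p≤T (proj₂ (T-spec x) x-noniso) (proj₂ (T-spec y) y-noniso)
... | U , x∈U , y∈U , U⊆T , ∣U∣≡p =
  x≢y ,
  commonPrey D U-nonisolated (proj₂ (C U ∣U∣≡p)) x∈U y∈U ,
  commonEnemy D U-nonisolated (proj₂ (C' U ∣U∣≡p)) x∈U y∈U
  where
  U-nonisolated : ∀ u → u ∈ U → ¬ Isolated D u
  U-nonisolated u u∈U = proj₁ (T-spec u) (U⊆T u∈U)
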